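{- Let $S$ be an infinite set and $\mathcal{F}\subseteq 2^S$ nontrivial and closed under finite unions. Let $\mathbf{A}=(A_1,\dots,A_k)$ be a classification problem with $k>1$. Then $\mathbf{A}\in\mathit{core}_k(\mathcal{F})$ if and only if $A_1\cup\dots\cup A_k$ is $\mathcal{F}$-cohesive.
   Context: $\mathcal{F}$ is nontrivial if $\emptyset,S\in\mathcal{F}$ and for all $Q\in\mathcal{F}$ and finite $E\subseteq S$ both $Q\cup E\in\mathcal{F}$ and $Q\setminus E\in\mathcal{F}$. A classification problem is a vector $(A_1,\dots,A_k)$, $k\ge1$, of pairwise disjoint infinite subsets of $S$, of length $k$. For vectors $\mathbf{B}=(B_1,\dots,B_m)$, $\mathbf{Q}=(Q_1,\dots,Q_k)$, $\mathbf{B}\le\mathbf{Q}$ means $1\le m\le k$ and there is an injective $\sigma:\{1,\dots,m\}\to\{1,\dots,k\}$ with $B_i\subseteq Q_{\sigma(i)}$. An $\mathcal{F}$-partition is a vector of pairwise disjoint members of $\mathcal{F}$ whose union is $S$. $\mathit{class}_k(\mathcal{F})$: classification problems $\mathbf{A}$ of length $k$ with $\mathbf{A}\le\mathbf{Q}$ for some $\mathcal{F}$-partition $\mathbf{Q}$ of length $k$. For $k>1$, $\mathit{core}_k(\mathcal{F})$ is the set of classification problems $\mathbf{A}$ of length $k$ such that every classification problem $\mathbf{A}'\le\mathbf{A}$ with $|\mathbf{A}'|>1$ satisfies $\mathbf{A}'\notin\mathit{class}_{|\mathbf{A}'|}(\mathcal{F})$. A set $A\subseteq S$ is $\mathcal{F}$-cohesive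 if $A$ is infinite and for every $Q$ with $Q\in\mathcal{F}$ and $S\setminus Q\in\mathcal{F}$, either $A\cap Q$ or $A\setminus Q$ is finite. -}

module Defs where

open import Data.Fin.Base using (Fin)
open import Data.List.Base using (List)
import Data.List.Membership.Propositional as List
open import Data.Nat.Base using (ℕ; _≤_; _<_)
open import Data.Product.Base using (Σ-syntax; _×_)
open import Data.Sum.Base using (_⊎_)
open import Data.Vec.Functional using (Vector)
open import Function.Definitions using (Injective)
open import Level using (Level; 0ℓ; suc; _⊔_)
open import Relation.Binary.PropositionalEquality.Core using (_≡_; _≢_)
open import Relation.Nullary.Negation.Core using (¬_)
open import Relation.Unary using (Pred; _∈_; _∉_; _⊆_; _≐_; _∪_; _∩_; _∖_; ∁; ⋃; _⊥_; ∅; U)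

private
  variable
    a f : Level
    k m : ℕ

-- Level 0ℓ loses no subsets classically: under excluded middle every predicate
-- on S, at any level, is extensionally equal to a Bool-valued one.
Subset : Set a → Set (a ⊔ suc 0ℓ)
Subset S = Pred S 0ℓ

-- Equality of subsets is _≐_, so a set of subsets is a family that also
-- satisfies 𝓕 Respects _≐_; the theorem assumes this separately.
Family : Set a → (f : Level) → Set (a ⊔ suc 0ℓ ⊔ suc f)
Family S f = Pred (Subset S) f

Finite : {S : Set a} → Subset S → Set a
Finite {S = S} A = Σ[ xs ∈ List S ] A ≐ (λ x → x List.∈ xs)

Infinite : {S : Set a} → Subset S → Set a
Infinite A = ¬ Finite A

record Nontrivial {S : Set a} (𝓕 : Family S f) : Set (a ⊔ suc 0ℓ ⊔ f) where
  field
    ∅∈𝓕        : ∅ ∈ 𝓕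
    S∈𝓕        : U ∈ 𝓕
    ∪-finite   : ∀ (Q E : Subset S) → Q ∈ 𝓕 → Finite E → (Q ∪ E) ∈ 𝓕
    ∖-finite   : ∀ (Q E : Subset S) → Q ∈ 𝓕 → Finite E → (Q ∖ E) ∈ 𝓕

ClosedUnderFiniteUnions : {S : Set a} → Family S f → Set (a ⊔ suc 0ℓ ⊔ f)
ClosedUnderFiniteUnions {S = S} 𝓕 =
  ∀ (n : ℕ) (Q : Vector (Subset S) n) → (∀ i → Q i ∈ 𝓕) → ⋃ (Fin n) Q ∈ 𝓕

PairwiseDisjoint : {S : Set a} → Vector (Subset S) k → Set a
PairwiseDisjoint A = ∀ i j → i ≢ j → A i ⊥ A j

record IsClassificationProblem {S : Set a} {k : ℕ} (A : Vector (Subset S) k) : Set a where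
  field
    nonempty : 1 ≤ k
    disjoint : PairwiseDisjoint A
    infinite : ∀ i → Infinite (A i)

infix 4 _≼_

_≼_ : {S : Set a} → Vector (Subset S) m → Vector (Subset S) k → Set a
_≼_ {m = m} {k = k} B Q =
  1 ≤ m × m ≤ k ×
  (Σ[ σ ∈ (Fin m → Fin k) ] Injective _≡_ _≡_ σ × (∀ i → B i ⊆ Q (σ i)))

record IsPartition {S : Set a} {k : ℕ} (𝓕 : Family S f) (Q : Vector (Subset S) k) : Set (a ⊔ f) where
  field
    members  : ∀ i → Q i ∈ 𝓕
    disjoint : PairwiseDisjoint Q
    covers   : ⋃ (Fin k) Q ≐ U

class : {S : Set a} (k : ℕ) → Family S f → Pred (Vector (Subset S) k) (a ⊔ suc 0ℓ ⊔ f)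
class {S = S} k 𝓕 A =
  IsClassificationProblem A ×
  (Σ[ Q ∈ Vector (Subset S) k ] IsPartition 𝓕 Q × A ≼ Q)

-- Meaningful only for 1 < k.
core : {S : Set a} (k : ℕ) → Family S f → Pred (Vector (Subset S) k) (a ⊔ suc 0ℓ ⊔ f)
core {S = S} k 𝓕 A =
  IsClassificationProblem A ×
  (∀ (m : ℕ) (A′ : Vector (Subset S) m) →
     IsClassificationProblem A′ → A′ ≼ A → 1 < m → A′ ∉ class m 𝓕)

Cohesive : {S : Set a} → Family S f → Pred (Subset S) (a ⊔ suc 0ℓ ⊔ f)
Cohesive {S = S} 𝓕 A =
  Infinite A ×
  (∀ (Q : Subset S) → Q ∈ 𝓕 → ∁ Q ∈ 𝓕 → Finite (A ∩ Q) ⊎ Finite (A ∖ Q))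

{-# OPTIONS --safe #-}

-- Call Q a splitter when both Q and its complement lie in 𝓕.  If the union of
-- the Aᵢ is not cohesive, some splitter Q has Aᵢ ∩ Q and Aⱼ ∖ Q infinite for
-- some i and j.  When i = j, any other component Aₗ meets Q or its complement
-- in an infinite set, so i ≠ j may be assumed, and (Q , ∁ Q) classifies
-- (Aᵢ ∩ Q , Aⱼ ∖ Q).  Conversely, each block of an 𝓕-partition is a splitter,
-- its complement being the union of the other blocks; the block containing the
-- first component of a classified A′ ≼ A then contradicts cohesiveness.
module Submission where

open import Defs
open import Axiom.ExcludedMiddle using (ExcludedMiddle)
open import Data.Empty using (⊥-elim)
open import Data.Fin.Base using (Fin; zero; suc)
open import Data.Fin.Properties using (_≟_; ¬∀⟶∃¬)
open import Data.List.Base as List using (_++_; filter)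
open import Data.List.Membership.Propositional.Properties using (∈-filter⁺; ∈-filter⁻; ∈-++⁺ˡ; ∈-++⁺ʳ; ∈-++⁻)
open import Data.Nat.Base using (ℕ; _<_; z≤n; s≤s)
open import Data.Product.Base using (∃-syntax; _×_; _,_; proj₁; proj₂)
open import Data.Sum.Base using (_⊎_; inj₁; inj₂; [_,_]′)
open import Data.Vec.Functional using (Vector; []; _∷_)
open import Function.Base using (_∘_)
open import Function.Bundles using (_⇔_; mk⇔)
open import Level using (Level; Lift; lift; lower)
open import Relation.Binary.Definitions using (_Respects_)
open import Relation.Binary.PropositionalEquality.Core using (_≢_; refl; sym)
open import Relation.Nullary.Decidable.Core using (yes; no; map′; toSum)
open import Relation.Nullary.Negation.Core using (¬_; contradiction)
open import Relation.Unary using (U; ∅; ∁; Decidable; _≐_; _∈_; _⊆_; _∪_; _∩_; _∖_; ⋃)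

private
  variable
    a f : Level
    S : Set a
    A B Q : Subset S
    k m : ℕ

-- Excluded middle is available at level `a`, while membership in a `Subset` lives at level zero;
-- `Lift` bridges the two.
decideSubset : ExcludedMiddle a → {S : Set a} (A : Subset S) → Decidable A
decideSubset {a = a} em A x = map′ lower lift (em {P = Lift a (A x)})

-- `Finite` asks for a list of exactly the elements of the set, so the list for `B` has to be
-- filtered by a decision procedure for `A`.
finite-⊆ : Decidable A → A ⊆ B → Finite B → Finite A
finite-⊆ A? A⊆B (xs , B⊆xs , xs⊆B) =
  filter A? xs ,
  (λ x∈A → ∈-filter⁺ A? (B⊆xs (A⊆B x∈A)) x∈A) ,
  (λ x∈ → proj₂ (∈-filter⁻ A? {xs = xs} x∈))

finite-∪ : Finite A → Finite B → Finite (A ∪ B)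
finite-∪ (xs , A⊆xs , xs⊆A) (ys , B⊆ys , ys⊆B) =
  xs ++ ys ,
  [ ∈-++⁺ˡ ∘ A⊆xs , ∈-++⁺ʳ xs ∘ B⊆ys ]′ ,
  ([ inj₁ ∘ xs⊆A , inj₂ ∘ ys⊆B ]′ ∘ ∈-++⁻ xs)

finite-resp-≐ : A ≐ B → Finite A → Finite B
finite-resp-≐ (A⊆B , B⊆A) (xs , A⊆xs , xs⊆A) = xs , A⊆xs ∘ B⊆A , A⊆B ∘ xs⊆A

finite-⋃ : ∀ k (A : Vector (Subset S) k) → (∀ i → Finite (A i)) → Finite (⋃ (Fin k) A)
finite-⋃ ℕ.zero    A fin = List.[] , (λ ()) , (λ ())
finite-⋃ (ℕ.suc k) A fin =
  finite-resp-≐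
    ( [ (zero ,_) , (λ (i , x∈Aᵢ) → suc i , x∈Aᵢ) ]′
    , (λ { (zero , x∈A₀) → inj₁ x∈A₀ ; (suc i , x∈Aᵢ) → inj₂ (i , x∈Aᵢ) }))
    (finite-∪ (fin zero) (finite-⋃ k (A ∘ suc) (fin ∘ suc)))

-- Contrapositive of `finite-⋃`: a search through `Fin k`, with finiteness decided by `em`, finds
-- the index.
infinite-⋃ : ExcludedMiddle a → {S : Set a} (A : Vector (Subset S) k) →
             Infinite (⋃ (Fin k) A) → ∃[ i ] Infinite (A i)
infinite-⋃ em A inf = ¬∀⟶∃¬ _ (Finite ∘ A) (λ _ → em) (inf ∘ finite-⋃ _ A)

-- Intersection distributes over the union. Since `A ∖ Q` unfolds to `A ∩ ∁ Q`, this serves both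
-- sides of `Q`.
infinite-⋃-∩ : ExcludedMiddle a → {S : Set a} (A : Vector (Subset S) k) (Q : Subset S) →
               Infinite (⋃ (Fin k) A ∩ Q) → ∃[ i ] Infinite (A i ∩ Q)
infinite-⋃-∩ em A Q inf = infinite-⋃ em (λ i → A i ∩ Q)
  (inf ∘ finite-resp-≐ ( (λ (i , x∈Aᵢ , x∈Q) → (i , x∈Aᵢ) , x∈Q)
                       , (λ ((i , x∈Aᵢ) , x∈Q) → i , x∈Aᵢ , x∈Q)))

infinite-splits : Decidable Q → Infinite A → Finite (A ∩ Q) → Infinite (A ∖ Q)
infinite-splits Q? inf fin∩ fin∖ = inf (finite-resp-≐
  ( [ proj₁ , proj₁ ]′
  , (λ {x} x∈A → [ (λ x∈Q → inj₁ (x∈A , x∈Q)) , (λ x∉Q → inj₂ (x∈A , x∉Q)) ]′ (toSum (Q? x))))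
  (finite-∪ fin∩ fin∖))

another : 1 < k → (i : Fin k) → ∃[ j ] j ≢ i
another (s≤s (s≤s _)) zero    = suc zero , λ ()
another (s≤s (s≤s _)) (suc i) = zero , λ ()

infinite-pair : ExcludedMiddle a → {S : Set a} → 1 < k →
                (A : Vector (Subset S) k) → (∀ i → Infinite (A i)) → (Q : Subset S) →
                Infinite (⋃ (Fin k) A ∩ Q) → Infinite (⋃ (Fin k) A ∖ Q) →
                ∃[ i ] ∃[ j ] i ≢ j × Infinite (A i ∩ Q) × Infinite (A j ∖ Q)
infinite-pair em 1<k A infA Q inf∩ inf∖
  with infinite-⋃-∩ em A Q inf∩ | infinite-⋃-∩ em A (∁ Q) inf∖
... | i , infᵢ | j , infⱼ with i ≟ j
... | no i≢j = i , j , i≢j , infᵢ , infⱼ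
-- Now `A i` is infinite on both sides of `Q`, so it can take whichever side is left over by `A l`.
... | yes refl with another 1<k i
... | l , l≢i with em {P = Finite (A l ∩ Q)}
... | yes finₗ = i , l , l≢i ∘ sym , infᵢ , infinite-splits (decideSubset em Q) (infA l) finₗ
... | no infₗ  = l , i , l≢i , infₗ , infⱼ

module _ {S : Set a} {𝓕 : Family S f} where

  ∁-partition : Decidable Q → Q ∈ 𝓕 → ∁ Q ∈ 𝓕 → IsPartition 𝓕 (Q ∷ ∁ Q ∷ [])
  ∁-partition Q? Q∈𝓕 ∁Q∈𝓕 = record
    { members  = λ { zero → Q∈𝓕 ; (suc zero) → ∁Q∈𝓕 }
    ; disjoint = λ { zero zero 0≢0 → contradiction refl 0≢0
                   ; zero (suc zero) _ (x∈Q , x∉Q) → x∉Q x∈Q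
                   ; (suc zero) zero _ (x∉Q , x∈Q) → x∉Q x∈Q
                   ; (suc zero) (suc zero) 1≢1 → contradiction refl 1≢1 }
    ; covers   = _ , λ {x} _ → [ (zero ,_) , (suc zero ,_) ]′ (toSum (Q? x))
    }

  ∁-block∈𝓕 : 𝓕 Respects _≐_ → ∅ ∈ 𝓕 → ClosedUnderFiniteUnions 𝓕 →
              (Q : Vector (Subset S) k) → IsPartition 𝓕 Q → ∀ i → ∁ (Q i) ∈ 𝓕
  ∁-block∈𝓕 {k = k} resp ∅∈𝓕 ⋃-closed Q part i =
    resp (⋃others⊆∁ , ∁⊆⋃others) (⋃-closed k others others∈𝓕)
    where
    open IsPartition part

    -- Block `i` is emptied rather than removed, which keeps the index type `Fin k`; `∅ ∈ 𝓕` makes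
    -- the emptied block a member.
    others : Vector (Subset S) k
    others j x = j ≢ i × Q j x

    others∈𝓕 : ∀ j → others j ∈ 𝓕
    others∈𝓕 j with j ≟ i
    ... | yes j≡i = resp ((λ ()) , λ (j≢i , _) → j≢i j≡i) ∅∈𝓕
    ... | no  j≢i = resp ((j≢i ,_) , proj₂) (members j)

    ⋃others⊆∁ : ⋃ (Fin k) others ⊆ ∁ (Q i)
    ⋃others⊆∁ (j , j≢i , x∈Qⱼ) x∈Qᵢ = disjoint j i j≢i (x∈Qⱼ , x∈Qᵢ)

    ∁⊆⋃others : ∁ (Q i) ⊆ ⋃ (Fin k) others
    ∁⊆⋃others x∉Qᵢ with proj₂ covers _
    ... | j , x∈Qⱼ = j , (λ { refl → x∉Qᵢ x∈Qⱼ }) , x∈Qⱼ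

  core⇒cohesive : ExcludedMiddle a → 1 < k → (A : Vector (Subset S) k) →
                  A ∈ core k 𝓕 → ⋃ (Fin k) A ∈ Cohesive 𝓕
  -- Matching on `1<k` exposes `k` as a successor, so that `zero` is an index in `inf⋃`.
  core⇒cohesive {k = k} em 1<k@(s≤s _) A (isA , unclassified) = inf⋃ , split
    where
    open IsClassificationProblem isA

    inf⋃ : Infinite (⋃ (Fin k) A)
    inf⋃ = infinite zero ∘ finite-⊆ (decideSubset em _) (zero ,_)

    split : ∀ Q → Q ∈ 𝓕 → ∁ Q ∈ 𝓕 → Finite (⋃ (Fin k) A ∩ Q) ⊎ Finite (⋃ (Fin k) A ∖ Q)
    split Q Q∈𝓕 ∁Q∈𝓕 with em {P = Finite (⋃ (Fin k) A ∩ Q)} | em {P = Finite (⋃ (Fin k) A ∖ Q)}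
    ... | yes fin∩ | _        = inj₁ fin∩
    ... | no  _    | yes fin∖ = inj₂ fin∖
    ... | no  inf∩ | no  inf∖ with infinite-pair em 1<k A infinite Q inf∩ inf∖
    ... | i , j , i≢j , infᵢ , infⱼ =
      ⊥-elim (unclassified 2 A′ isA′ A′≼A (s≤s (s≤s z≤n))
        (isA′ , Q ∷ ∁ Q ∷ [] , ∁-partition (decideSubset em Q) Q∈𝓕 ∁Q∈𝓕 , A′≼Q))
      where
      A′ : Vector (Subset S) 2
      A′ = A i ∩ Q ∷ A j ∖ Q ∷ []

      isA′ : IsClassificationProblem A′
      isA′ = record
        { nonempty = s≤s z≤n
        ; disjoint = λ { zero zero 0≢0 → contradiction refl 0≢0
                       ; zero (suc zero) _ ((_ , x∈Q) , (_ , x∉Q)) → x∉Q x∈Q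
                       ; (suc zero) zero _ ((_ , x∉Q) , (_ , x∈Q)) → x∉Q x∈Q
                       ; (suc zero) (suc zero) 1≢1 → contradiction refl 1≢1 }
        ; infinite = λ { zero → infᵢ ; (suc zero) → infⱼ }
        }

      A′≼A : A′ ≼ A
      -- The components of `A′` are disjoint because `Q` separates them; `i≢j` is what makes the
      -- choice of components of `A` injective.
      A′≼A = s≤s z≤n , 1<k , i ∷ j ∷ [] ,
        (λ { {zero}     {zero}     _   → refl
           ; {zero}     {suc zero} i≡j → contradiction i≡j i≢j
           ; {suc zero} {zero}     j≡i → contradiction (sym j≡i) i≢j
           ; {suc zero} {suc zero} _   → refl }) ,
        λ { zero → proj₁ ; (suc zero) → proj₁ }

      A′≼Q : A′ ≼ (Q ∷ ∁ Q ∷ [])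
      A′≼Q = s≤s z≤n , s≤s (s≤s z≤n) , (λ i → i) , (λ i≡j → i≡j) ,
        λ { zero → proj₂ ; (suc zero) → proj₂ }

  cohesive⇒unclassified :
    ExcludedMiddle a → 𝓕 Respects _≐_ → ∅ ∈ 𝓕 → ClosedUnderFiniteUnions 𝓕 →
    (A : Vector (Subset S) k) → ⋃ (Fin k) A ∈ Cohesive 𝓕 →
    (A′ : Vector (Subset S) m) → A′ ≼ A → 1 < m → ¬ (A′ ∈ class m 𝓕)
  cohesive⇒unclassified em resp ∅∈𝓕 ⋃-closed A (_ , split)
    A′ (_ , _ , σ , _ , A′⊆A) (s≤s (s≤s _)) (isA′ , Q , part , _ , _ , τ , τ-inj , A′⊆Q) =
    -- If the union is finite inside the block `Q (τ zero)`, then so is `A′ zero`, which lies in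
    -- both.
    [ infinite zero ∘ finite-⊆ (decideSubset em _)
        (λ x∈A′₀ → (σ zero , A′⊆A zero x∈A′₀) , A′⊆Q zero x∈A′₀)
    -- If it is finite outside that block, then so is `A′ (suc zero)`: injectivity of `τ` puts it
    -- into a different, hence disjoint, block.
    , infinite (suc zero) ∘ finite-⊆ (decideSubset em _)
        (λ x∈A′₁ → (σ (suc zero) , A′⊆A (suc zero) x∈A′₁) ,
          λ x∈Q₀ → IsPartition.disjoint part _ _ τ₀≢τ₁ (x∈Q₀ , A′⊆Q (suc zero) x∈A′₁))
    ]′ (split (Q (τ zero)) (IsPartition.members part (τ zero))
         (∁-block∈𝓕 resp ∅∈𝓕 ⋃-closed Q part (τ zero)))
    where
    open IsClassificationProblem isA′

    τ₀≢τ₁ : τ zero ≢ τ (suc zero)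
    τ₀≢τ₁ τ₀≡τ₁ with τ-inj τ₀≡τ₁
    ... | ()

theorem3p5 : ∀ {a f : Level} → ExcludedMiddle a →
    (S : Set a) → Infinite {S = S} U →
    (𝓕 : Family S f) → 𝓕 Respects _≐_ → Nontrivial 𝓕 → ClosedUnderFiniteUnions 𝓕 →
    (k : ℕ) → 1 < k →
    (A : Vector (Subset S) k) → IsClassificationProblem A →
    (A ∈ core k 𝓕) ⇔ (⋃ (Fin k) A ∈ Cohesive 𝓕)
theorem3p5 em S _ 𝓕 resp nontrivial ⋃-closed k 1<k A isA = mk⇔
  (core⇒cohesive em 1<k A)
  -- Cohesiveness concerns only the union, so that `A` is a classification problem comes from the
  -- hypothesis `isA`.
  (λ cohesive → isA , λ m A′ _ A′≼A 1<m →
    cohesive⇒unclassified em resp (Nontrivial.∅∈𝓕 nontrivial) ⋃-closed A cohesive A′ A′≼A 1<m)
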